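{- Let $\mathbf L=(L,\vee,\wedge,*)$ be a sectionally pseudocomplemented lattice with greatest element $1$ and let $\Theta\in\operatorname{Con}\mathbf L$. Then $[1]\Theta\in\operatorname{Fil}\mathbf L$, and for any $x,y\in L$, $$(x,y)\in\Theta\text{ if and only if }x*y,\,y*x\in[1]\Theta,$$ i.e. $\Phi([1]\Theta)=\Theta$.
   Context: A lattice $(L,\vee,\wedge)$ is sectionally pseudocomplemented if for all $a,b\in L$ there exists a greatest element $c$ of $L$ satisfying $(a\vee b)\wedge c=b$; this $c$ is denoted by $a*b$. Sectionally pseudocomplemented lattices are regarded as algebras $(L,\vee,\wedge,*)$ of type $(2,2,2)$. Only non-empty lattices are considered; then there is a greatest element $1$ (namely $x*x=1$ for every $x\in L$). $\operatorname{Con}\mathbf L$ is the set of congruences of the algebra $(L,\vee,\wedge,*)$, and $[1]\Theta$ is the $\Theta$-class of $1$. A filter of $\mathbf L$ is a subset $F$ of $L$ containing $1$ such that, for all $x,y,z\in L$, $x*y,y*x\in F$ implies $(x\vee z)*(y\vee z),\ (x\wedge z)*(y\wedge z),\ (x*z)*(y*z),\ (z*x)*(z*y)\in F$. $\operatorname{Fil}\mathbf L$ is the set of all filters of $\mathbf L$. For $M\subseteq L$ put $\Phi(M):=\{(x,y)\in L^2\mid x*y,\,y*x\in M\}$. -}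

module Defs where

open import Algebra.Core using (Op₂)
open import Algebra.Definitions using (Congruent₂)
open import Algebra.Lattice.Bundles using (Lattice)
import Algebra.Lattice.Properties.Lattice as LatticeProperties
open import Data.Product.Base using (_×_)
open import Level using (Level; suc; _⊔_)
open import Relation.Binary.Bundles using (Poset)
open import Relation.Binary.Core using (Rel; _⇒_)
open import Relation.Binary.Definitions using (_Respects_)
open import Relation.Binary.Structures using (IsEquivalence)
open import Relation.Unary using (Pred; _∈_)

private
  variable
    a ℓ p r : Level

IsGreatest : {A : Set a} → Rel A ℓ → Pred A p → A → Set (a ⊔ ℓ ⊔ p)
IsGreatest _≤_ P m = m ∈ P × (∀ c → c ∈ P → c ≤ m)

record SectionallyPseudocomplementedLattice c ℓ : Set (suc (c ⊔ ℓ)) where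
  field
    lattice : Lattice c ℓ

  open Lattice lattice public

  -- The library's order of a lattice: x ≤ y unfolds to x ≈ x ∧ y.
  open Poset (LatticeProperties.poset lattice) public using (_≤_)

  infixr 8 _*_

  -- Compatibility of _*_ with _≈_ is not a field: it follows from the
  -- uniqueness (up to _≈_) of greatest elements.
  field
    _*_        : Op₂ Carrier
    *-greatest : ∀ a b → IsGreatest _≤_ (λ c → (a ∨ b) ∧ c ≈ b) (a * b)

module _ {c ℓ} (L : SectionallyPseudocomplementedLattice c ℓ) where
  open SectionallyPseudocomplementedLattice L

  -- Since _≈_ plays the role of equality, a congruence has to contain it.
  record IsCongruence (Θ : Rel Carrier r) : Set (c ⊔ ℓ ⊔ r) where
    field
      isEquivalence : IsEquivalence Θ
      ≈⇒Θ           : _≈_ ⇒ Θ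
      ∨-compatible  : Congruent₂ Θ _∨_
      ∧-compatible  : Congruent₂ Θ _∧_
      *-compatible  : Congruent₂ Θ _*_

  -- Likewise, a subset has to be closed under _≈_.
  record IsFilter (1# : Carrier) (F : Pred Carrier p) : Set (c ⊔ ℓ ⊔ p) where
    field
      respects-≈ : F Respects _≈_
      1∈F        : 1# ∈ F
      ∨-closed   : ∀ x y z → x * y ∈ F → y * x ∈ F → (x ∨ z) * (y ∨ z) ∈ F
      ∧-closed   : ∀ x y z → x * y ∈ F → y * x ∈ F → (x ∧ z) * (y ∧ z) ∈ F
      *-closedʳ  : ∀ x y z → x * y ∈ F → y * x ∈ F → (x * z) * (y * z) ∈ F
      *-closedˡ  : ∀ x y z → x * y ∈ F → y * x ∈ F → (z * x) * (z * y) ∈ F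

  class : Carrier → Rel Carrier r → Pred Carrier r
  class x Θ y = Θ y x

  Φ : Pred Carrier p → Rel Carrier p
  Φ M x y = x * y ∈ M × y * x ∈ M

{-# OPTIONS --safe #-}

-- If x Θ y then x * y Θ y * y ≈ 1.  Conversely, meeting x * y Θ 1 with x ∨ y
-- turns the defining equation (x ∨ y) ∧ (x * y) ≈ y into y Θ x ∨ y; by symmetry
-- x Θ y ∨ x, hence x Θ y.  Through this equivalence the filter conditions on the
-- class of 1 become the compatibility of Θ with the operations.
module Submission where

open import Defs
import Algebra.Lattice.Properties.Lattice as LatticeProperties
open import Data.Product.Base using (_×_; _,_; proj₁; proj₂)
open import Function.Bundles using (_⇔_; mk⇔)
open import Relation.Binary.Bundles using (Poset)
open import Relation.Binary.Core using (Rel; _⇒_) renaming (_⇔_ to _≐_)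
open import Relation.Binary.Definitions using (Maximum)
open import Relation.Binary.Structures using (IsEquivalence)
open import Relation.Unary using (_∈_)

module _ {c ℓ} (L : SectionallyPseudocomplementedLattice c ℓ) where
  open SectionallyPseudocomplementedLattice L
  open LatticeProperties lattice using (∨-idem; poset)

  module _ (1# : Carrier) (maximum : Maximum _≤_ 1#) where

    ∧-identityʳ : ∀ x → x ∧ 1# ≈ x
    ∧-identityʳ x = sym (maximum x)

    -- `1#` itself satisfies the condition that defines `x * x`, since `(x ∨ x) ∧ 1#` collapses to
    -- `x`; the greatest such element is therefore above `1#`.
    x*x≈1 : ∀ x → x * x ≈ 1#
    x*x≈1 x = Poset.antisym poset (maximum (x * x))
      (proj₂ (*-greatest x x) 1# (trans (∧-identityʳ (x ∨ x)) (∨-idem x)))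

    module _ {r} {Θ : Rel Carrier r} (isCongruence : IsCongruence L Θ) where
      open IsCongruence isCongruence hiding (isEquivalence)
      private module Θ = IsEquivalence (IsCongruence.isEquivalence isCongruence)

      Θ⇒*∈class : ∀ {x y} → Θ x y → x * y ∈ class L 1# Θ
      Θ⇒*∈class {y = y} xΘy =
        Θ.trans (*-compatible xΘy Θ.refl) (≈⇒Θ (x*x≈1 y))

      -- In the quotient by `Θ` the conclusion reads "`x` lies below `y`": one membership yields one
      -- inequality, and `Φ⇒Θ` combines the two as antisymmetry does.
      *∈class⇒Θ∨ : ∀ {x y} → x * y ∈ class L 1# Θ → Θ y (x ∨ y)
      *∈class⇒Θ∨ {x} {y} x*yΘ1 =
        Θ.trans (≈⇒Θ (sym (proj₁ (*-greatest x y))))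
          (Θ.trans (∧-compatible Θ.refl x*yΘ1) (≈⇒Θ (∧-identityʳ (x ∨ y))))

      Θ⇒Φ : Θ ⇒ Φ L (class L 1# Θ)
      Θ⇒Φ xΘy = Θ⇒*∈class xΘy , Θ⇒*∈class (Θ.sym xΘy)

      Φ⇒Θ : Φ L (class L 1# Θ) ⇒ Θ
      Φ⇒Θ {x} {y} (x*yΘ1 , y*xΘ1) =
        Θ.trans (*∈class⇒Θ∨ y*xΘ1)
          (Θ.trans (≈⇒Θ (∨-comm y x)) (Θ.sym (*∈class⇒Θ∨ x*yΘ1)))

      class-isFilter : IsFilter L 1# (class L 1# Θ)
      class-isFilter = record
        -- Membership of `x` in the class unfolds to `Θ x 1#`, so the first two fields are
        -- transitivity and reflexivity of `Θ`.
        { respects-≈ = λ x≈y xΘ1 → Θ.trans (≈⇒Θ (sym x≈y)) xΘ1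
        ; 1∈F        = Θ.refl
        -- The hypotheses `p` and `q` together give `Θ x y`; `Θ.refl` keeps `z` fixed while the
        -- operation is applied, and `Θ⇒*∈class` leads back into the class.
        ; ∨-closed   = λ _ _ _ p q → Θ⇒*∈class (∨-compatible (Φ⇒Θ (p , q)) Θ.refl)
        ; ∧-closed   = λ _ _ _ p q → Θ⇒*∈class (∧-compatible (Φ⇒Θ (p , q)) Θ.refl)
        ; *-closedʳ  = λ _ _ _ p q → Θ⇒*∈class (*-compatible (Φ⇒Θ (p , q)) Θ.refl)
        ; *-closedˡ  = λ _ _ _ p q → Θ⇒*∈class (*-compatible Θ.refl (Φ⇒Θ (p , q)))
        }

theorem2p4 : ∀ {c ℓ r} (L : SectionallyPseudocomplementedLattice c ℓ) →
    let open SectionallyPseudocomplementedLattice L in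
    (1# : Carrier) → Maximum _≤_ 1# →
    (Θ : Rel Carrier r) → IsCongruence L Θ →
    IsFilter L 1# (class L 1# Θ)
    × (∀ x y → Θ x y ⇔ (x * y ∈ class L 1# Θ × y * x ∈ class L 1# Θ))
    × (Φ L (class L 1# Θ) ≐ Θ)
theorem2p4 L 1# maximum Θ isCongruence =
    class-isFilter L 1# maximum isCongruence
  , (λ _ _ → mk⇔ (Θ⇒Φ L 1# maximum isCongruence) (Φ⇒Θ L 1# maximum isCongruence))
  , (Φ⇒Θ L 1# maximum isCongruence , Θ⇒Φ L 1# maximum isCongruence)
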